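{- For any positive integers $k,n$, one has $D^{\mathrm{perm}}_k(n)\le 4\cdot D^{\mathrm{mon}}_k(n)$.
   Context: Monotone matrices: a matrix $A$ with $m$ rows and $n$ columns is $k$-monotone if $A\in\{0,1,\dots,k\}^{m\times n}$ and $A_{1j}\le\dots\le A_{mj}$ for every column $j$. The linear discrepancy of $A\in\mathbb R^{m\times n}$ is $\mathrm{lindisc}(A)=\max_{y\in[0,1]^n}\min_{x\in\{0,1\}^n}\|Ax-Ay\|_\infty$. $D^{\mathrm{mon}}_k(n)$ is the maximum of $\mathrm{lindisc}(A)$ over all $k$-monotone matrices $A\in\mathbb Z^{m\times n}$ with $n$ columns and any number $m$ of rows. Discrepancy of permutations: write $[n]=\{1,\dots,n\}$. For a set system $\mathcal S\subseteq2^{[n]}$, $\mathrm{disc}(\mathcal S)=\min_{\chi:[n]\to\{\pm1\}}\max_{S\in\mathcal S}|\chi(S)|$ with $\chi(S)=\sum_{i\in S}\chi(i)$. Permutations $\pi_1,\dots,\pi_k$ of $[n]$ induce the set system $\{\{\pi_i(1),\dots,\pi_i(j)\} : j=1,\dots,n;\ i=1,\dots,k\}$. $D^{\mathrm{perm}}_k(n)$ is the maximum discrepancy of such a set system over all choices of $k$ permutations of $[n]$. -}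

module Defs where

open import Algebra.Bundles.Raw using (RawMonoid)
open import Algebra.Core using (Op₁; Op₂)
import Algebra.Definitions.RawMonoid as Sum
open import Data.Bool.Base using (if_then_else_)
open import Data.Fin.Base as Fin using (Fin)
open import Data.Fin.Permutation using (Permutation′; _⟨$⟩ʳ_)
import Data.Fin.Properties as Fin
open import Data.Fin.Subset using (Subset; ⁅_⁆; ⋃)
open import Data.Integer.Base as ℤ using (ℤ; 0ℤ)
open import Data.List.Base as List using (List; allFin; cartesianProductWith; filter)
open import Data.Nat.Base as ℕ using (ℕ; zero; suc)
import Data.Nat.Properties as ℕ
open import Data.Product.Base using (Σ; _×_; _,_; ∃-syntax)
open import Data.Rational.Base
open import Data.Rational.Properties
open import Data.Rational.Solver using (module +-*-Solver)
open import Data.Sign.Base as Sign using (Sign)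
open import Data.Sum.Base using (inj₁; inj₂)
import Data.Vec.Base as Vec
open import Data.Vec.Functional as Vector using (Vector; []; _∷_)
open import Function.Base using (_∘_)
open import Level using (Level; 0ℓ)
open import Relation.Binary.Core using (Rel)
open import Relation.Binary.PropositionalEquality.Core
  using (_≡_; refl; sym; cong; cong₂; subst)

private
  variable
    a b i ℓ₁ ℓ₂ : Level
    k m n : ℕ

private
  p≤∣p∣ : ∀ p → p ≤ ∣ p ∣
  p≤∣p∣ p with ≤-total 0ℚ p
  ... | inj₁ 0≤p = ≤-reflexive (sym (0≤p⇒∣p∣≡p 0≤p))
  ... | inj₂ p≤0 = ≤-trans p≤0 (0≤∣p∣ p)

  ∣p-q∣≡∣q-p∣ : ∀ p q → ∣ p - q ∣ ≡ ∣ q - p ∣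
  ∣p-q∣≡∣q-p∣ p q = begin-equality
    ∣ p - q ∣      ≡⟨ cong ∣_∣ (solve 2 (λ p q → p :- q := :- (q :- p)) refl p q) ⟩
    ∣ - (q - p) ∣  ≡⟨ ∣-p∣≡∣p∣ (q - p) ⟩
    ∣ q - p ∣      ∎
    where
    open ≤-Reasoning
    open +-*-Solver

  p≤q+∣p-q∣ : ∀ p q → p ≤ q + ∣ p - q ∣
  p≤q+∣p-q∣ p q = begin
    p              ≡⟨ solve 2 (λ p q → p := q :+ (p :- q)) refl p q ⟩
    q + (p - q)    ≤⟨ +-monoʳ-≤ q (p≤∣p∣ (p - q)) ⟩
    q + ∣ p - q ∣  ∎
    where
    open ≤-Reasoning
    open +-*-Solver

  p≤q+ε⇒p-q≤ε : ∀ {p q ε} → p ≤ q + ε → p - q ≤ ε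
  p≤q+ε⇒p-q≤ε {p} {q} {ε} p≤q+ε = begin
    p - q      ≤⟨ +-monoˡ-≤ (- q) p≤q+ε ⟩
    q + ε - q  ≡⟨ solve 2 (λ q ε → q :+ ε :- q := ε) refl q ε ⟩
    ε          ∎
    where
    open ≤-Reasoning
    open +-*-Solver

  ∣p-q∣≤ε : ∀ {p q ε} → p ≤ q + ε → q ≤ p + ε → ∣ p - q ∣ ≤ ε
  ∣p-q∣≤ε {p} {q} {ε} p≤q+ε q≤p+ε with ∣p∣≡p∨∣p∣≡-p (p - q)
  ... | inj₁ eq = subst (_≤ ε) (sym eq) (p≤q+ε⇒p-q≤ε p≤q+ε)
  ... | inj₂ eq = subst (_≤ ε) (sym eq)
    (subst (_≤ ε) (solve 2 (λ p q → q :- p := :- (p :- q)) refl p q) (p≤q+ε⇒p-q≤ε q≤p+ε))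
    where
    open +-*-Solver

  Nonexpansive : Op₂ ℚ → Set
  Nonexpansive f = ∀ p q r s → ∣ f p q - f r s ∣ ≤ ∣ p - r ∣ + ∣ q - s ∣

  one-sided⇒nonexpansive : ∀ f → (∀ p q r s → f p q ≤ f r s + (∣ p - r ∣ + ∣ q - s ∣)) →
                           Nonexpansive f
  one-sided⇒nonexpansive f f≤ p q r s = ∣p-q∣≤ε (f≤ p q r s)
    (subst (λ d → f r s ≤ f p q + d) (cong₂ _+_ (∣p-q∣≡∣q-p∣ r p) (∣p-q∣≡∣q-p∣ s q)) (f≤ r s p q))

  p≤r+∣p-r∣+∣q-s∣ : ∀ p q r s → p ≤ r + (∣ p - r ∣ + ∣ q - s ∣)
  p≤r+∣p-r∣+∣q-s∣ p q r s = ≤-trans (p≤q+∣p-q∣ p r) (+-monoʳ-≤ r (p≤p+q {{nonNegative (0≤∣p∣ (q - s))}}))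
    where
    p≤p+q : ∀ {p q} → .{{NonNegative q}} → p ≤ p + q
    p≤p+q {p} {q} = subst (_≤ p + q) (+-identityʳ p) (+-monoʳ-≤ p (nonNegative⁻¹ q))

  q≤s+∣p-r∣+∣q-s∣ : ∀ p q r s → q ≤ s + (∣ p - r ∣ + ∣ q - s ∣)
  q≤s+∣p-r∣+∣q-s∣ p q r s =
    subst (λ d → q ≤ s + d) (+-comm ∣ q - s ∣ ∣ p - r ∣) (p≤r+∣p-r∣+∣q-s∣ q p s r)

  +-nonexpansive : Nonexpansive _+_
  +-nonexpansive p q r s = begin
    ∣ (p + q) - (r + s) ∣  ≡⟨ cong ∣_∣ (solve 4 (λ p q r s →
                                (p :+ q) :- (r :+ s) := (p :- r) :+ (q :- s)) refl p q r s) ⟩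
    ∣ (p - r) + (q - s) ∣  ≤⟨ ∣p+q∣≤∣p∣+∣q∣ (p - r) (q - s) ⟩
    ∣ p - r ∣ + ∣ q - s ∣  ∎
    where
    open ≤-Reasoning
    open +-*-Solver

  ⊔-nonexpansive : Nonexpansive _⊔_
  ⊔-nonexpansive = one-sided⇒nonexpansive _⊔_ λ p q r s → ⊔-lub
    (≤-trans (p≤r+∣p-r∣+∣q-s∣ p q r s) (+-monoˡ-≤ _ (p≤p⊔q r s)))
    (≤-trans (q≤s+∣p-r∣+∣q-s∣ p q r s) (+-monoˡ-≤ _ (p≤q⊔p r s)))

  ⊓-nonexpansive : Nonexpansive _⊓_
  ⊓-nonexpansive = one-sided⇒nonexpansive _⊓_ λ p q r s →
    subst (p ⊓ q ≤_) (sym (mono-≤-distrib-⊓ (+-monoˡ-≤ (∣ p - r ∣ + ∣ q - s ∣)) r s))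
      (⊓-mono-≤ (p≤r+∣p-r∣+∣q-s∣ p q r s) (q≤s+∣p-r∣+∣q-s∣ p q r s))

  ∣∣p∣-∣q∣∣≤∣p-q∣ : ∀ p q → ∣ ∣ p ∣ - ∣ q ∣ ∣ ≤ ∣ p - q ∣
  ∣∣p∣-∣q∣∣≤∣p-q∣ p q = ∣p-q∣≤ε (∣p∣≤ p q)
    (subst (λ d → ∣ q ∣ ≤ ∣ p ∣ + d) (∣p-q∣≡∣q-p∣ q p) (∣p∣≤ q p))
    where
    ∣p∣≤ : ∀ p q → ∣ p ∣ ≤ ∣ q ∣ + ∣ p - q ∣
    ∣p∣≤ p q = begin
      ∣ p ∣              ≡⟨ cong ∣_∣ (solve 2 (λ p q → p := q :+ (p :- q)) refl p q) ⟩
      ∣ q + (p - q) ∣    ≤⟨ ∣p+q∣≤∣p∣+∣q∣ q (p - q) ⟩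
      ∣ q ∣ + ∣ p - q ∣  ∎
      where
      open ≤-Reasoning
      open +-*-Solver

  ∣-p--q∣≡∣p-q∣ : ∀ p q → ∣ - p - - q ∣ ≡ ∣ p - q ∣
  ∣-p--q∣≡∣p-q∣ p q = begin-equality
    ∣ - p - - q ∣  ≡⟨ cong ∣_∣ (solve 2 (λ p q → :- p :- :- q := :- (p :- q)) refl p q) ⟩
    ∣ - (p - q) ∣  ≡⟨ ∣-p∣≡∣p∣ (p - q) ⟩
    ∣ p - q ∣      ∎
    where
    open ≤-Reasoning
    open +-*-Solver

  ∣pq-rs∣≤ : ∀ p q r s → ∣ p * q - r * s ∣ ≤ ∣ p ∣ * ∣ q - s ∣ + ∣ s ∣ * ∣ p - r ∣
  ∣pq-rs∣≤ p q r s = begin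
    ∣ p * q - r * s ∣                      ≡⟨ cong ∣_∣ (solve 4 (λ p q r s →
      p :* q :- r :* s := p :* (q :- s) :+ s :* (p :- r)) refl p q r s) ⟩
    ∣ p * (q - s) + s * (p - r) ∣          ≤⟨ ∣p+q∣≤∣p∣+∣q∣ (p * (q - s)) (s * (p - r)) ⟩
    ∣ p * (q - s) ∣ + ∣ s * (p - r) ∣      ≡⟨ cong₂ _+_ (∣p*q∣≡∣p∣*∣q∣ p (q - s)) (∣p*q∣≡∣p∣*∣q∣ s (p - r)) ⟩
    ∣ p ∣ * ∣ q - s ∣ + ∣ s ∣ * ∣ p - r ∣  ∎
    where
    open ≤-Reasoning
    open +-*-Solver

  *-mono-≤-abs : ∀ {p q r s} → ∣ p ∣ ≤ r → ∣ q ∣ ≤ s → ∣ p ∣ * ∣ q ∣ ≤ r * s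
  *-mono-≤-abs {p} {q} {r} {s} p≤r q≤s = ≤-trans
    (*-monoʳ-≤-nonNeg ∣ q ∣ {{∣-∣-nonNeg q}} p≤r)
    (*-monoˡ-≤-nonNeg r {{nonNegative (≤-trans (0≤∣p∣ p) p≤r)}} q≤s)

-- Real numbers are Cauchy sequences of rationals, compared by the
-- setoid equality _≈ℝ_.
IsCauchy : (ℕ → ℚ) → Set
IsCauchy x = ∀ ε → 0ℚ < ε → ∃[ N ] ∀ i j → N ℕ.≤ i → N ℕ.≤ j → ∣ x i - x j ∣ ≤ ε

record ℝ : Set where
  constructor mkℝ
  field
    approx : ℕ → ℚ
    cauchy : IsCauchy approx

open ℝ public

infix 4 _≤ℝ_ _≈ℝ_

_≤ℝ_ : Rel ℝ 0ℓ
x ≤ℝ y = ∀ ε → 0ℚ < ε → ∃[ N ] ∀ i → N ℕ.≤ i → approx x i ≤ approx y i + ε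

_≈ℝ_ : Rel ℝ 0ℓ
x ≈ℝ y = x ≤ℝ y × y ≤ℝ x

fromℚ : ℚ → ℝ
fromℚ p = mkℝ (λ _ → p) λ ε 0<ε → 0 , λ _ _ _ _ →
  subst (_≤ ε) (sym (cong ∣_∣ (+-inverseʳ p))) (<⇒≤ 0<ε)

fromℕ : ℕ → ℝ
fromℕ n = fromℚ (ℤ.+ n / 1)

0ℝ 1ℝ : ℝ
0ℝ = fromℚ 0ℚ
1ℝ = fromℚ 1ℚ

private
  0<½*ε : ∀ {ε} → 0ℚ < ε → 0ℚ < ½ * ε
  0<½*ε {ε} 0<ε = positive⁻¹ (½ * ε) {{pos*pos⇒pos ½ ε {{positive 0<ε}}}}

  ½*ε+½*ε≡ε : ∀ ε → ½ * ε + ½ * ε ≡ ε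
  ½*ε+½*ε≡ε = solve 1 (λ ε → con ½ :* ε :+ con ½ :* ε := ε) refl
    where
    open +-*-Solver

  lift₂ : (f : Op₂ ℚ) → Nonexpansive f → Op₂ ℝ
  lift₂ f f-nonexp x y = mkℝ (λ i → f (approx x i) (approx y i)) λ ε 0<ε →
    let N₁ , x-close = cauchy x (½ * ε) (0<½*ε 0<ε)
        N₂ , y-close = cauchy y (½ * ε) (0<½*ε 0<ε)
    in N₁ ℕ.⊔ N₂ , λ i j N≤i N≤j →
      ≤-trans (f-nonexp (approx x i) (approx y i) (approx x j) (approx y j))
        (subst (_ ≤_) (½*ε+½*ε≡ε ε) (+-mono-≤
          (x-close i j (ℕ.m⊔n≤o⇒m≤o N₁ N₂ N≤i) (ℕ.m⊔n≤o⇒m≤o N₁ N₂ N≤j))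
          (y-close i j (ℕ.m⊔n≤o⇒n≤o N₁ N₂ N≤i) (ℕ.m⊔n≤o⇒n≤o N₁ N₂ N≤j))))

infixl 6 _+ℝ_ _-ℝ_ _⊔ℝ_
infixl 7 _*ℝ_ _⊓ℝ_
infix  8 -ℝ_

_+ℝ_ _⊔ℝ_ _⊓ℝ_ : Op₂ ℝ
_+ℝ_ = lift₂ _+_ +-nonexpansive
_⊔ℝ_ = lift₂ _⊔_ ⊔-nonexpansive
_⊓ℝ_ = lift₂ _⊓_ ⊓-nonexpansive

-ℝ_ : Op₁ ℝ
-ℝ x = mkℝ (-_ ∘ approx x) λ ε 0<ε →
  let N , x-close = cauchy x ε 0<ε
  in N , λ i j N≤i N≤j →
    subst (_≤ ε) (sym (∣-p--q∣≡∣p-q∣ (approx x i) (approx x j))) (x-close i j N≤i N≤j)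

_-ℝ_ : Op₂ ℝ
x -ℝ y = x +ℝ (-ℝ y)

∣_∣ℝ : Op₁ ℝ
∣ x ∣ℝ = mkℝ (∣_∣ ∘ approx x) λ ε 0<ε →
  let N , x-close = cauchy x ε 0<ε
  in N , λ i j N≤i N≤j →
    ≤-trans (∣∣p∣-∣q∣∣≤∣p-q∣ (approx x i) (approx x j)) (x-close i j N≤i N≤j)

private
  eventually-bounded : ∀ x → ∃[ B ] 0ℚ < B × ∃[ N ] ∀ i → N ℕ.≤ i → ∣ approx x i ∣ ≤ B
  eventually-bounded x =
    let N , x-close = cauchy x 1ℚ (positive⁻¹ 1ℚ)
    in ∣ approx x N ∣ + 1ℚ
     , +-mono-≤-< (0≤∣p∣ (approx x N)) (positive⁻¹ 1ℚ)
     , N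
     , λ i N≤i → ≤-trans (p≤q+∣p-q∣ ∣ approx x i ∣ ∣ approx x N ∣) (+-monoʳ-≤ ∣ approx x N ∣
         (≤-trans (∣∣p∣-∣q∣∣≤∣p-q∣ (approx x i) (approx x N)) (x-close i N N≤i ℕ.≤-refl)))

  fraction : ∀ {C ε} → 0ℚ < C → 0ℚ < ε → ∃[ δ ] 0ℚ < δ × C * δ ≡ ε
  fraction {C} {ε} 0<C 0<ε = 1/ C * ε , positive⁻¹ (1/ C * ε) , C*δ≡ε
    where
    instance
      C-pos : Positive C
      C-pos = positive 0<C
      C-nonZero : NonZero C
      C-nonZero = pos⇒nonZero C
      ε-pos : Positive ε
      ε-pos = positive 0<ε
      1/C-pos : Positive (1/ C)
      1/C-pos = 1/pos⇒pos C
      δ-pos : Positive (1/ C * ε)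
      δ-pos = pos*pos⇒pos (1/ C) ε
    C*δ≡ε : C * (1/ C * ε) ≡ ε
    C*δ≡ε = begin-equality
      C * (1/ C * ε)  ≡⟨ *-assoc C (1/ C) ε ⟨
      C * 1/ C * ε    ≡⟨ cong (_* ε) (*-inverseʳ C) ⟩
      1ℚ * ε          ≡⟨ *-identityˡ ε ⟩
      ε               ∎
      where
      open ≤-Reasoning

  *-close : ∀ {p q r s B C δ ε} → ∣ p ∣ ≤ B → ∣ s ∣ ≤ C → ∣ p - r ∣ ≤ δ → ∣ q - s ∣ ≤ δ →
            (B + C) * δ ≡ ε → ∣ p * q - r * s ∣ ≤ ε
  *-close {p} {q} {r} {s} {B} {C} {δ} {ε} p≤B s≤C p-r≤δ q-s≤δ [B+C]*δ≡ε = begin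
    ∣ p * q - r * s ∣                      ≤⟨ ∣pq-rs∣≤ p q r s ⟩
    ∣ p ∣ * ∣ q - s ∣ + ∣ s ∣ * ∣ p - r ∣  ≤⟨ +-mono-≤ (*-mono-≤-abs {p} {q - s} p≤B q-s≤δ)
                                                       (*-mono-≤-abs {s} {p - r} s≤C p-r≤δ) ⟩
    B * δ + C * δ                          ≡⟨ *-distribʳ-+ δ B C ⟨
    (B + C) * δ                            ≡⟨ [B+C]*δ≡ε ⟩
    ε                                      ∎
    where
    open ≤-Reasoning

  m⊔n⊔o⊔p≤q⇒ : ∀ m n o p {q} → (m ℕ.⊔ n) ℕ.⊔ (o ℕ.⊔ p) ℕ.≤ q →
               m ℕ.≤ q × n ℕ.≤ q × o ℕ.≤ q × p ℕ.≤ q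
  m⊔n⊔o⊔p≤q⇒ m n o p le =
      ℕ.m⊔n≤o⇒m≤o m n (ℕ.m⊔n≤o⇒m≤o (m ℕ.⊔ n) (o ℕ.⊔ p) le)
    , ℕ.m⊔n≤o⇒n≤o m n (ℕ.m⊔n≤o⇒m≤o (m ℕ.⊔ n) (o ℕ.⊔ p) le)
    , ℕ.m⊔n≤o⇒m≤o o p (ℕ.m⊔n≤o⇒n≤o (m ℕ.⊔ n) (o ℕ.⊔ p) le)
    , ℕ.m⊔n≤o⇒n≤o o p (ℕ.m⊔n≤o⇒n≤o (m ℕ.⊔ n) (o ℕ.⊔ p) le)

  *-cauchy : ∀ x y → IsCauchy (λ i → approx x i * approx y i)
  *-cauchy x y ε 0<ε =
    choose-δ (eventually-bounded x) (eventually-bounded y)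
    where
    Bounded : ℝ → Set
    Bounded x = ∃[ B ] 0ℚ < B × ∃[ N ] ∀ i → N ℕ.≤ i → ∣ approx x i ∣ ≤ B

    Close : ℝ → ℚ → Set
    Close x δ = ∃[ N ] ∀ i j → N ℕ.≤ i → N ℕ.≤ j → ∣ approx x i - approx x j ∣ ≤ δ

    close : ∀ {δ} ((B , _) : Bounded x) ((C , _) : Bounded y) → (B + C) * δ ≡ ε →
            Close x δ → Close y δ →
            ∃[ N ] ∀ i j → N ℕ.≤ i → N ℕ.≤ j →
              ∣ approx x i * approx y i - approx x j * approx y j ∣ ≤ ε
    close (B , _ , N₁ , x-bounded) (C , _ , N₂ , y-bounded) [B+C]*δ≡ε
          (N₃ , x-close) (N₄ , y-close) =
      (N₁ ℕ.⊔ N₂) ℕ.⊔ (N₃ ℕ.⊔ N₄) , λ i j N≤i N≤j →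
        let N₁≤i , _ , N₃≤i , N₄≤i = m⊔n⊔o⊔p≤q⇒ N₁ N₂ N₃ N₄ N≤i
            _ , N₂≤j , N₃≤j , N₄≤j = m⊔n⊔o⊔p≤q⇒ N₁ N₂ N₃ N₄ N≤j
        in *-close {approx x i} {approx y i} {approx x j} {approx y j}
             (x-bounded i N₁≤i) (y-bounded j N₂≤j)
             (x-close i j N₃≤i N₃≤j) (y-close i j N₄≤i N₄≤j) [B+C]*δ≡ε

    choose-δ : Bounded x → Bounded y →
               ∃[ N ] ∀ i j → N ℕ.≤ i → N ℕ.≤ j →
                 ∣ approx x i * approx y i - approx x j * approx y j ∣ ≤ ε
    choose-δ bx@(B , 0<B , _) by@(C , 0<C , _) =
      choose-N (fraction {B + C} (+-mono-< {0ℚ} {B} {0ℚ} {C} 0<B 0<C) 0<ε)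
      where
      choose-N : ∃[ δ ] 0ℚ < δ × (B + C) * δ ≡ ε → _
      choose-N (δ , 0<δ , [B+C]*δ≡ε) =
        close {δ} bx by [B+C]*δ≡ε (cauchy x δ 0<δ) (cauchy y δ 0<δ)

_*ℝ_ : Op₂ ℝ
x *ℝ y = mkℝ (λ i → approx x i * approx y i) (*-cauchy x y)

+-0-rawMonoid-ℝ : RawMonoid 0ℓ 0ℓ
+-0-rawMonoid-ℝ = record { _≈_ = _≈ℝ_ ; _∙_ = _+ℝ_ ; ε = 0ℝ }

sumℝ : Vector ℝ n → ℝ
sumℝ = Sum.sum +-0-rawMonoid-ℝ

sumℤ : Vector ℤ n → ℤ
sumℤ = Sum.sum ℤ.+-0-rawMonoid

module Maximum {A : Set a} (_≈_ : Rel A ℓ₁) (_≤_ : Rel A ℓ₂) where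

  UpperBound : {I : Set i} → (I → A) → A → Set _
  UpperBound f v = ∀ i → f i ≤ v

  IsMaximum : {I : Set i} → (I → A) → A → Set _
  IsMaximum f v = (∃[ i ] f i ≈ v) × UpperBound f v

-- The minimum, with respect to the meet operation _⊓_, of f over the 2ⁿ
-- vectors all of whose entries are b₀ or b₁.
minOver : {A : Set a} {B : Set b} → Op₂ A → B → B → (Vector B n → A) → A
minOver {n = zero}  _⊓_ b₀ b₁ f = f []
minOver {n = suc n} _⊓_ b₀ b₁ f =
  minOver _⊓_ b₀ b₁ (λ x → f (b₀ ∷ x)) ⊓ minOver _⊓_ b₀ b₁ (λ x → f (b₁ ∷ x))

open Maximum _≈ℝ_ _≤ℝ_ using () renaming (UpperBound to UpperBoundℝ; IsMaximum to IsMaximumℝ)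

Matrix : Set a → ℕ → ℕ → Set a
Matrix A m n = Fin m → Fin n → A

infixr 8 _*ᵥ_

_*ᵥ_ : Matrix ℝ m n → Vector ℝ n → Vector ℝ m
(A *ᵥ x) i = sumℝ (λ j → A i j *ℝ x j)

_-ᵥ_ : Vector ℝ n → Vector ℝ n → Vector ℝ n
(x -ᵥ y) i = x i -ℝ y i

‖_‖∞ : Vector ℝ n → ℝ
‖ x ‖∞ = Vector.foldr _⊔ℝ_ 0ℝ (λ i → ∣ x i ∣ℝ)

-- [0,1]ⁿ
UnitCube : ℕ → Set
UnitCube n = Σ (Vector ℝ n) λ y → ∀ j → 0ℝ ≤ℝ y j × y j ≤ℝ 1ℝ

-- min over x ∈ {0,1}ⁿ of ‖ A x − A y ‖∞
roundingError : Matrix ℝ m n → UnitCube n → ℝ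
roundingError A (y , _) = minOver _⊓ℝ_ 0ℝ 1ℝ (λ x → ‖ (A *ᵥ x) -ᵥ (A *ᵥ y) ‖∞)

-- IsLindisc A v says that v is the maximum lindisc A.  It is a relation because
-- the maximum over a cube of reals is not computed by a function.
IsLindisc : Matrix ℝ m n → ℝ → Set
IsLindisc A = IsMaximumℝ (roundingError A)

-- lindisc A ≤ v, by the defining property of the maximum.
LindiscAtMost : Matrix ℝ m n → ℝ → Set
LindiscAtMost A = UpperBoundℝ (roundingError A)

IsMonotone : ℕ → Matrix ℕ m n → Set
IsMonotone k A =
  (∀ i j → A i j ℕ.≤ k) × (∀ {i i′} → i Fin.≤ i′ → ∀ j → A i j ℕ.≤ A i′ j)

toReal : Matrix ℕ m n → Matrix ℝ m n
toReal A i j = fromℕ (A i j)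

-- IsDmon k n d says that d is the maximum of lindisc A over the k-monotone
-- matrices A with n columns: it is a value of lindisc and bounds all of them.
IsDmon : ℕ → ℕ → ℝ → Set
IsDmon k n d =
  (∃[ m ] Σ (Matrix ℕ m n) λ A → IsMonotone k A × IsLindisc (toReal A) d) ×
  (∀ {m} (A : Matrix ℕ m n) → IsMonotone k A → LindiscAtMost (toReal A) d)

SetSystem : ℕ → Set
SetSystem n = List (Subset n)

_⟨_⟩ : Vector Sign n → Subset n → ℤ
χ ⟨ S ⟩ = sumℤ (λ i → if Vec.lookup S i then χ i ℤ.◃ 1 else 0ℤ)

disc : SetSystem n → ℕ
disc 𝒮 = minOver ℕ._⊓_ Sign.- Sign.+
  (λ χ → List.foldr ℕ._⊔_ 0 (List.map (λ S → ℤ.∣ χ ⟨ S ⟩ ∣) 𝒮))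

-- { π(0), …, π(j) }
prefix : Permutation′ n → Fin n → Subset n
prefix {n} π j = ⋃ (List.map (λ i → ⁅ π ⟨$⟩ʳ i ⁆) (filter (Fin._≤? j) (allFin n)))

prefixes : (Fin k → Permutation′ n) → SetSystem n
prefixes {k} {n} π = cartesianProductWith (λ i j → prefix (π i) j) (allFin k) (allFin n)

open Maximum (_≡_ {A = ℕ}) ℕ._≤_ using () renaming (IsMaximum to IsMaximumℕ)

IsDperm : ℕ → ℕ → ℕ → Set
IsDperm k n = IsMaximumℕ (λ (π : Fin k → Permutation′ n) → disc (prefixes π))

-- Given permutations π₁, …, π_k, take the monotone matrix whose row (i , j) is
-- (i − 1) · 𝟏 plus the indicator vector of { π_i(1), …, π_i(j) }, and round the
-- point ½ · 𝟏 to x ∈ {0,1}ⁿ with error at most D in every row. For the signs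
-- χ = 2x − 𝟏 every row has |χ(row)| ≤ 2D, and each prefix is the difference of
-- the rows (i , j) and (i , 0), so |χ(prefix)| ≤ 4D.
module Submission where

open import Defs
open import Data.Nat.Base using (ℕ; NonZero)

open import Algebra.Core using (Op₂)
import Algebra.Definitions.RawMonoid as RawMonoid
open import Data.Bool.Base using (true; false; if_then_else_)
open import Data.Empty using (⊥-elim)
open import Data.Fin.Base as Fin using (Fin; toℕ; combine; remQuot)
open import Data.Fin.Permutation using (Permutation′; _⟨$⟩ʳ_; _⟨$⟩ˡ_; inverseʳ; inverseˡ)
import Data.Fin.Properties as Fin
open import Data.Fin.Subset using (Subset; _∈_; ⋃; ⁅_⁆)
open import Data.Fin.Subset.Properties using (x∈p∪q⁺; x∈p∪q⁻; x∈⁅x⁆; x∈⁅y⁆⇒x≡y; ∉⊥)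
open import Data.Integer.Base as ℤ using (ℤ; +_; -[1+_]; 0ℤ)
import Data.Integer.Properties as ℤ
open import Data.List.Base as List using (List; allFin; filter)
open import Data.List.Membership.Propositional using () renaming (_∈_ to _∈ₗ_)
open import Data.List.Membership.Propositional.Properties
  using (∈-filter⁺; ∈-filter⁻; ∈-allFin; ∈-map⁺; ∈-map⁻)
open import Data.List.Properties using (foldr-preservesᵇ)
import Data.List.Relation.Unary.All.Properties as All
open import Data.List.Relation.Unary.Any using (here; there)
open import Data.Nat.Base as ℕ using (zero; suc; z≤n; s≤s)
import Data.Nat.Properties as ℕ
open import Data.Product.Base using (_×_; _,_; proj₁; proj₂; uncurry; ∃-syntax)
open import Data.Rational.Base hiding (NonZero)
open import Data.Rational.Properties
open import Data.Rational.Solver using (module +-*-Solver)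
import Data.Rational.Unnormalised.Base as ℚᵘ
import Data.Rational.Unnormalised.Properties as ℚᵘ
open import Data.Sign.Base as Sign using (Sign)
open import Data.Sum.Base as Sum using (_⊎_; inj₁; inj₂; [_,_]′)
import Data.Vec.Base as Vec
open import Data.Vec.Functional using (Vector; []; _∷_)
open import Data.Vec.Properties using ([]=⇒lookup; lookup⇒[]=)
open import Function.Base using (_∘_; const)
open import Level using (Level)
open import Relation.Binary.Definitions using (tri<; tri≈; tri>)
open import Relation.Binary.PropositionalEquality
  using (_≡_; _≗_; refl; sym; trans; cong; cong₂; subst; subst₂; setoid; module ≡-Reasoning)
open import Relation.Nullary.Decidable using (yes; no)
open import Relation.Unary using (Pred)

private
  variable
    a b ℓ : Level
    k m n : ℕ

-- Minima over binary vectors, and the discrepancy of a colouring.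

-- `P` has to be checked only at vectors with entries `b₀` or `b₁`; this is the source of the later
-- hypothesis that the rounded vector is binary.
minOver-preserves : {A : Set a} {B : Set b} (P : Pred A ℓ) {_⊓′_ : Op₂ A} →
                    (∀ {u v} → P u → P v → P (u ⊓′ v)) → ∀ {b₀ b₁ : B} (f : Vector B n → A) →
                    (∀ x → (∀ j → x j ≡ b₀ ⊎ x j ≡ b₁) → P (f x)) → P (minOver _⊓′_ b₀ b₁ f)
minOver-preserves {n = zero}  P ⊓-pres f Pf = Pf [] λ ()
minOver-preserves {n = suc n} P ⊓-pres {b₀} {b₁} f Pf = ⊓-pres (half b₀ (inj₁ refl)) (half b₁ (inj₂ refl))
  where
  half : ∀ b → b ≡ b₀ ⊎ b ≡ b₁ → _
  half b b-ok = minOver-preserves P ⊓-pres (λ x → f (b ∷ x)) λ x x-ok →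
    Pf (b ∷ x) λ { Fin.zero → b-ok ; (Fin.suc j) → x-ok j }

-- Invariance under pointwise equality stands in for function extensionality: the recursion rebuilds
-- `χ` with `_∷_`, and the result agrees with `χ` only pointwise.
minOver-≤ : (f : Vector Sign n → ℕ) → (∀ {χ ψ} → χ ≗ ψ → f χ ≡ f ψ) →
            ∀ χ → minOver ℕ._⊓_ Sign.- Sign.+ f ℕ.≤ f χ
minOver-≤ {zero}  f f-cong χ = ℕ.≤-reflexive (f-cong λ ())
minOver-≤ {suc n} f f-cong χ with χ Fin.zero in χ₀
... | Sign.- = ℕ.≤-trans (ℕ.m⊓n≤m _ _) (ℕ.≤-trans
      (minOver-≤ (λ x → f (Sign.- ∷ x)) (λ eq → f-cong λ { Fin.zero → refl ; (Fin.suc j) → eq j }) (χ ∘ Fin.suc))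
      (ℕ.≤-reflexive (f-cong λ { Fin.zero → sym χ₀ ; (Fin.suc j) → refl })))
... | Sign.+ = ℕ.≤-trans (ℕ.m⊓n≤n _ _) (ℕ.≤-trans
      (minOver-≤ (λ x → f (Sign.+ ∷ x)) (λ eq → f-cong λ { Fin.zero → refl ; (Fin.suc j) → eq j }) (χ ∘ Fin.suc))
      (ℕ.≤-reflexive (f-cong λ { Fin.zero → sym χ₀ ; (Fin.suc j) → refl })))

sumℤ-cong : {u v : Vector ℤ n} → u ≗ v → sumℤ u ≡ sumℤ v
sumℤ-cong {zero}  eq = refl
sumℤ-cong {suc n} eq = cong₂ ℤ._+_ (eq Fin.zero) (sumℤ-cong (eq ∘ Fin.suc))

maxDisc : SetSystem n → Vector Sign n → ℕ
maxDisc 𝒮 χ = List.foldr ℕ._⊔_ 0 (List.map (λ S → ℤ.∣ χ ⟨ S ⟩ ∣) 𝒮)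

⟨⟩-cong : {χ ψ : Vector Sign n} (S : Subset n) → χ ≗ ψ → χ ⟨ S ⟩ ≡ ψ ⟨ S ⟩
⟨⟩-cong S eq = sumℤ-cong λ i → cong (λ s → if Vec.lookup S i then s ℤ.◃ 1 else 0ℤ) (eq i)

maxDisc-cong : (𝒮 : SetSystem n) {χ ψ : Vector Sign n} → χ ≗ ψ → maxDisc 𝒮 χ ≡ maxDisc 𝒮 ψ
maxDisc-cong List.[]      eq = refl
maxDisc-cong (S List.∷ 𝒮) eq =
  cong₂ ℕ._⊔_ (cong ℤ.∣_∣ (⟨⟩-cong S eq)) (maxDisc-cong 𝒮 eq)

-- Integers inside the rationals.

-- `_/_` normalises its result, so the identity is checked on unnormalised fractions with
-- denominator 1.
/1-homo-+ : ∀ i j → (i ℤ.+ j) / 1 ≡ i / 1 + j / 1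
/1-homo-+ i j = toℚᵘ-injective (begin-equality
  toℚᵘ ((i ℤ.+ j) / 1)               ≃⟨ toℚᵘ-fromℚᵘ (ℚᵘ.mkℚᵘ (i ℤ.+ j) 0) ⟩
  ℚᵘ.mkℚᵘ (i ℤ.+ j) 0                ≃⟨ ℚᵘ.*≡* (cong (ℤ._* + 1) (cong₂ ℤ._+_ (sym (ℤ.*-identityʳ i)) (sym (ℤ.*-identityʳ j)))) ⟩
  ℚᵘ.mkℚᵘ i 0 ℚᵘ.+ ℚᵘ.mkℚᵘ j 0       ≃⟨ ℚᵘ.+-cong (toℚᵘ-fromℚᵘ (ℚᵘ.mkℚᵘ i 0)) (toℚᵘ-fromℚᵘ (ℚᵘ.mkℚᵘ j 0)) ⟨
  toℚᵘ (i / 1) ℚᵘ.+ toℚᵘ (j / 1)     ≃⟨ toℚᵘ-homo-+ (i / 1) (j / 1) ⟨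
  toℚᵘ (i / 1 + j / 1)               ∎)
  where open ℚᵘ.≤-Reasoning

/1-mono-≤ : ∀ {i j} → i ℤ.≤ j → i / 1 ≤ j / 1
/1-mono-≤ {i} {j} i≤j = toℚᵘ-cancel-≤ (begin
  toℚᵘ (i / 1)  ≃⟨ toℚᵘ-fromℚᵘ (ℚᵘ.mkℚᵘ i 0) ⟩
  ℚᵘ.mkℚᵘ i 0   ≤⟨ ℚᵘ.*≤* (ℤ.*-monoʳ-≤-nonNeg (+ 1) i≤j) ⟩
  ℚᵘ.mkℚᵘ j 0   ≃⟨ toℚᵘ-fromℚᵘ (ℚᵘ.mkℚᵘ j 0) ⟨
  toℚᵘ (j / 1)  ∎)
  where open ℚᵘ.≤-Reasoning

∣i∣/1≡∣i/1∣ : ∀ i → + ℤ.∣ i ∣ / 1 ≡ ∣ i / 1 ∣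
∣i∣/1≡∣i/1∣ (+ n)    = sym (0≤p⇒∣p∣≡p (/1-mono-≤ (ℤ.+≤+ (z≤n {n}))))
∣i∣/1≡∣i/1∣ -[1+ n ] = trans (∣i∣/1≡∣i/1∣ (+ suc n)) (sym (∣-p∣≡∣p∣ (+ suc n / 1)))

2ℚ 4ℚ : ℚ
2ℚ = + 2 / 1
4ℚ = + 4 / 1

-- Rounding errors at a fixed approximation index.

0≤approx-‖‖∞ : (v : Vector ℝ n) → ∀ t → 0ℚ ≤ approx ‖ v ‖∞ t
0≤approx-‖‖∞ {zero}  v t = ≤-refl
0≤approx-‖‖∞ {suc n} v t = ≤-trans (0≤∣p∣ (approx (v Fin.zero) t)) (p≤p⊔q _ _)

∣v∣≤‖v‖∞ : (v : Vector ℝ n) → ∀ i t → ∣ approx (v i) t ∣ ≤ approx ‖ v ‖∞ t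
∣v∣≤‖v‖∞ v Fin.zero    t = p≤p⊔q _ _
∣v∣≤‖v‖∞ v (Fin.suc i) t = ≤-trans (∣v∣≤‖v‖∞ (v ∘ Fin.suc) i t) (p≤q⊔p ∣ approx (v Fin.zero) t ∣ _)

sumℚ : Vector ℚ n → ℚ
sumℚ = RawMonoid.sum +-0-rawMonoid

approx-sumℝ : (v : Vector ℝ n) → ∀ t → approx (sumℝ v) t ≡ sumℚ (λ j → approx (v j) t)
approx-sumℝ {zero}  v t = refl
approx-sumℝ {suc n} v t = cong (λ p → approx (v Fin.zero) t + p) (approx-sumℝ (v ∘ Fin.suc) t)

-- Kept as a difference of two sums, the shape in which the entries of Ax - Ay compute.
rowError : (u x y : Vector ℚ n) → ℚ
rowError u x y = sumℚ (λ j → u j * x j) - sumℚ (λ j → u j * y j)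

approx-rowError : (A : Matrix ℝ m n) (x y : Vector ℝ n) → ∀ r t →
  approx (((A *ᵥ x) -ᵥ (A *ᵥ y)) r) t ≡
  rowError (λ j → approx (A r j) t) (λ j → approx (x j) t) (λ j → approx (y j) t)
approx-rowError A x y r t =
  cong₂ _-_ (approx-sumℝ (λ j → A r j *ℝ x j) t) (approx-sumℝ (λ j → A r j *ℝ y j) t)

∣rowError∣≤ : (A : Matrix ℝ m n) (x y : Vector ℝ n) → ∀ r t →
  ∣ rowError (λ j → approx (A r j) t) (λ j → approx (x j) t) (λ j → approx (y j) t) ∣ ≤
  approx ‖ (A *ᵥ x) -ᵥ (A *ᵥ y) ‖∞ t
∣rowError∣≤ A x y r t = subst (λ e → ∣ e ∣ ≤ approx ‖ (A *ᵥ x) -ᵥ (A *ᵥ y) ‖∞ t) (approx-rowError A x y r t)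
  (∣v∣≤‖v‖∞ ((A *ᵥ x) -ᵥ (A *ᵥ y)) r t)

-- The meet of two rationals is one of them, so at a fixed index `t` the minimum is the error of an
-- actual binary vector. Working index by index avoids deciding which of two reals is smaller; the
-- vector may change with `t`.
approx-roundingError : (P : Pred ℚ ℓ) (A : Matrix ℝ m n) (y : UnitCube n) → ∀ t →
  (∀ x → (∀ j → x j ≡ 0ℚ ⊎ x j ≡ 1ℚ) → ∀ {B} → 0ℚ ≤ B →
     (∀ r → ∣ rowError (λ j → approx (A r j) t) x (λ j → approx (proj₁ y j) t) ∣ ≤ B) → P B) →
  P (approx (roundingError A y) t)
approx-roundingError P A y t PB = minOver-preserves (λ v → P (approx v t))
  (λ {u} {v} Pu Pv → [ (λ eq → subst P (sym eq) Pu) , (λ eq → subst P (sym eq) Pv) ]′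
    (⊓-sel (approx u t) (approx v t)))
  (λ x → ‖ (A *ᵥ x) -ᵥ (A *ᵥ proj₁ y) ‖∞)
  λ x binary → PB (λ j → approx (x j) t)
    (λ j → Sum.map (cong (λ y → approx y t)) (cong (λ y → approx y t)) (binary j))
    (0≤approx-‖‖∞ ((A *ᵥ x) -ᵥ (A *ᵥ proj₁ y)) t)
    (λ r → ∣rowError∣≤ A x (proj₁ y) r t)

-- Signed sums as differences of row errors.

row-difference-step : ∀ c h u v x ux uh vx vh →
  c * ((u - v) * (x - h)) + c * ((ux - uh) - (vx - vh)) ≡
  c * (((u * x + ux) - (u * h + uh)) - ((v * x + vx) - (v * h + vh)))
row-difference-step = solve 9 (λ c h u v x ux uh vx vh →
    c :* ((u :- v) :* (x :- h)) :+ c :* ((ux :- uh) :- (vx :- vh)) :=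
    c :* (((u :* x :+ ux) :- (u :* h :+ uh)) :- ((v :* x :+ vx) :- (v :* h :+ vh))))
  refl
  where open +-*-Solver

-- Both errors are taken against the constant vector ½, so by linearity their difference is the row
-- u - v applied to x - ½. Twice this is u - v applied to the signs 2x - 1.
sumℤ-as-row-difference : (u v x : Vector ℚ n) (z : Vector ℤ n) →
  (∀ j → z j / 1 ≡ 2ℚ * ((u j - v j) * (x j - ½))) →
  sumℤ z / 1 ≡ 2ℚ * (rowError u x (const ½) - rowError v x (const ½))
sumℤ-as-row-difference {zero}  u v x z eq = refl
sumℤ-as-row-difference {suc n} u v x z eq = begin
  sumℤ z / 1                                     ≡⟨ /1-homo-+ (z Fin.zero) (sumℤ (z ∘ Fin.suc)) ⟩
  z Fin.zero / 1 + sumℤ (z ∘ Fin.suc) / 1        ≡⟨ cong₂ _+_ (eq Fin.zero)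
    (sumℤ-as-row-difference (u ∘ Fin.suc) (v ∘ Fin.suc) (x ∘ Fin.suc) (z ∘ Fin.suc) (eq ∘ Fin.suc)) ⟩
  _                                              ≡⟨ row-difference-step 2ℚ ½ (u Fin.zero) (v Fin.zero) (x Fin.zero)
    (sumℚ (λ j → u (Fin.suc j) * x (Fin.suc j))) (sumℚ (λ j → u (Fin.suc j) * ½))
    (sumℚ (λ j → v (Fin.suc j) * x (Fin.suc j))) (sumℚ (λ j → v (Fin.suc j) * ½)) ⟩
  2ℚ * (rowError u x (const ½) - rowError v x (const ½))  ∎
  where open ≡-Reasoning

-- Membership in prefixes.

x∈⋃⁺ : ∀ {x : Fin n} {p} ps → p ∈ₗ ps → x ∈ p → x ∈ ⋃ ps
x∈⋃⁺ (p List.∷ ps) (here refl)  x∈p = x∈p∪q⁺ (inj₁ x∈p)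
x∈⋃⁺ (_ List.∷ ps) (there p∈ps) x∈p = x∈p∪q⁺ (inj₂ (x∈⋃⁺ ps p∈ps x∈p))

x∈⋃⁻ : ∀ {x : Fin n} ps → x ∈ ⋃ ps → ∃[ p ] p ∈ₗ ps × x ∈ p
x∈⋃⁻ List.[]       x∈⋃ = ⊥-elim (∉⊥ x∈⋃)
x∈⋃⁻ (p List.∷ ps) x∈⋃ with x∈p∪q⁻ p (⋃ ps) x∈⋃
... | inj₁ x∈p = p , here refl , x∈p
... | inj₂ x∈⋃ps = let q , q∈ps , x∈q = x∈⋃⁻ ps x∈⋃ps in q , there q∈ps , x∈q

-- The union runs over positions, whereas the matrix entry in column `l` tests the position of `l`;
-- the inverse permutation translates between the two.
∈-prefix⁺ : (π : Permutation′ n) → ∀ {j l} → π ⟨$⟩ˡ l Fin.≤ j → l ∈ prefix π j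
∈-prefix⁺ π {j} {l} l≤j = x∈⋃⁺ _
  (∈-map⁺ (λ i → ⁅ π ⟨$⟩ʳ i ⁆) (∈-filter⁺ (Fin._≤? j) (∈-allFin (π ⟨$⟩ˡ l)) l≤j))
  (subst (λ i → l ∈ ⁅ i ⁆) (sym (inverseʳ π)) (x∈⁅x⁆ l))

∈-prefix⁻ : (π : Permutation′ n) → ∀ {j l} → l ∈ prefix π j → π ⟨$⟩ˡ l Fin.≤ j
∈-prefix⁻ π {j} {l} l∈ with x∈⋃⁻ (List.map (λ i → ⁅ π ⟨$⟩ʳ i ⁆) (filter (Fin._≤? j) (allFin _))) l∈
... | p , p∈ , l∈p with ∈-map⁻ (λ i → ⁅ π ⟨$⟩ʳ i ⁆) p∈
...   | i , i∈ , refl with x∈⁅y⁆⇒x≡y (π ⟨$⟩ʳ i) l∈p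
...     | refl = subst (Fin._≤ j) (sym (inverseˡ π)) (proj₂ (∈-filter⁻ (Fin._≤? j) {xs = allFin _} i∈))

-- The stacked matrix and its monotonicity.

-- The comparison is strict, so threshold 0 selects no position and threshold j + 1 selects the
-- positions 0, ..., j.
indicator : ℕ → ℕ → ℕ
indicator p q with p ℕ.<? q
... | yes _ = 1
... | no _  = 0

indicator≤1 : ∀ p q → indicator p q ℕ.≤ 1
indicator≤1 p q with p ℕ.<? q
... | yes _ = ℕ.≤-refl
... | no _  = z≤n

indicator-monoʳ-≤ : ∀ p {q r} → q ℕ.≤ r → indicator p q ℕ.≤ indicator p r
indicator-monoʳ-≤ p {q} {r} q≤r with p ℕ.<? q | p ℕ.<? r
... | yes p<q | yes _  = ℕ.≤-refl
... | yes p<q | no p≮r = ⊥-elim (p≮r (ℕ.≤-trans p<q q≤r))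
... | no _    | _      = z≤n

-- Block i has only the entries i and i + 1, so none of them exceeds an entry of a later block, and
-- i < k keeps them within k.
blockEntry : (Fin k → Permutation′ n) → Fin k × Fin (suc n) → Fin n → ℕ
blockEntry π (i , j) l = toℕ i ℕ.+ indicator (toℕ (π i ⟨$⟩ˡ l)) (toℕ j)

-- Indices start at 0, so the multiple of 𝟏 is toℕ i; j ranges over 0, …, n.
prefixMatrix : (Fin k → Permutation′ n) → Matrix ℕ (k ℕ.* suc n) n
prefixMatrix {n = n} π r = blockEntry π (remQuot (suc n) r)

blockEntry-combine : (π : Fin k → Permutation′ n) → ∀ i j l →
                     prefixMatrix π (combine i j) l ≡ blockEntry π (i , j) l
blockEntry-combine π i j l = cong (λ r → blockEntry π r l) (Fin.remQuot-combine i j)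

-- Pairs are numbered block by block: inside one block the common offset cancels, and every index of
-- a later block is strictly larger.
combine-≤⇒lex : (i i′ : Fin m) (j j′ : Fin n) → combine i j Fin.≤ combine i′ j′ →
                i Fin.< i′ ⊎ (i ≡ i′ × j Fin.≤ j′)
combine-≤⇒lex {n = n} i i′ j j′ le with Fin.<-cmp i i′
... | tri< i<i′ _ _ = inj₁ i<i′
... | tri≈ _ refl _ = inj₂ (refl , ℕ.+-cancelˡ-≤ (n ℕ.* toℕ i) _ _
        (subst₂ ℕ._≤_ (Fin.toℕ-combine i j) (Fin.toℕ-combine i j′) le))
... | tri> _ _ i>i′ = ⊥-elim (ℕ.<⇒≱ (Fin.combine-monoˡ-< j′ j i>i′) le)

prefixMatrix-monotone : (π : Fin k → Permutation′ n) → IsMonotone k (prefixMatrix π)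
prefixMatrix-monotone {k} {n} π = bounded , λ {r} {r′} → monotone {r} {r′}
  where
  entry≤ : ∀ i j l → blockEntry π (i , j) l ℕ.≤ suc (toℕ i)
  entry≤ i j l = ℕ.≤-trans (ℕ.+-monoʳ-≤ (toℕ i) (indicator≤1 _ (toℕ j))) (ℕ.≤-reflexive (ℕ.+-comm (toℕ i) 1))

  bounded : ∀ r l → prefixMatrix π r l ℕ.≤ k
  bounded r l = ℕ.≤-trans (entry≤ _ _ l) (Fin.toℕ<n (proj₁ (remQuot {k} (suc n) r)))

  lex-monotone : ∀ p p′ → uncurry combine p Fin.≤ uncurry combine p′ →
                 ∀ l → blockEntry π p l ℕ.≤ blockEntry π p′ l
  lex-monotone (i , j) (i′ , j′) le l with combine-≤⇒lex i i′ j j′ le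
  ... | inj₁ i<i′          = ℕ.≤-trans (entry≤ i j l) (ℕ.≤-trans i<i′ (ℕ.m≤m+n _ _))
  ... | inj₂ (refl , j≤j′) = ℕ.+-monoʳ-≤ (toℕ i) (indicator-monoʳ-≤ _ j≤j′)

  monotone : ∀ {r r′} → r Fin.≤ r′ → ∀ l → prefixMatrix π r l ℕ.≤ prefixMatrix π r′ l
  monotone {r} {r′} r≤r′ = lex-monotone (remQuot (suc n) r) (remQuot (suc n) r′)
    (subst₂ Fin._≤_ (sym (Fin.combine-remQuot {k} (suc n) r)) (sym (Fin.combine-remQuot {k} (suc n) r′)) r≤r′)

-- From a rounded vector to a colouring.

-- One factor 2 comes from the signs 2x - 1, the other from the triangle inequality over two rows.
∣2[p-q]∣≤4r : ∀ {p q r} → ∣ p ∣ ≤ r → ∣ q ∣ ≤ r → ∣ 2ℚ * (p - q) ∣ ≤ 4ℚ * r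
∣2[p-q]∣≤4r {p} {q} {r} ∣p∣≤r ∣q∣≤r = begin
  ∣ 2ℚ * (p - q) ∣         ≡⟨ ∣p*q∣≡∣p∣*∣q∣ 2ℚ (p - q) ⟩
  2ℚ * ∣ p - q ∣           ≤⟨ *-monoˡ-≤-nonNeg 2ℚ (∣p+q∣≤∣p∣+∣q∣ p (- q)) ⟩
  2ℚ * (∣ p ∣ + ∣ - q ∣)   ≡⟨ cong (λ s → 2ℚ * (∣ p ∣ + s)) (∣-p∣≡∣p∣ q) ⟩
  2ℚ * (∣ p ∣ + ∣ q ∣)     ≤⟨ *-monoˡ-≤-nonNeg 2ℚ (+-mono-≤ ∣p∣≤r ∣q∣≤r) ⟩
  2ℚ * (r + r)             ≡⟨ solve 1 (λ r → con 2ℚ :* (r :+ r) := con 4ℚ :* r) refl r ⟩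
  4ℚ * r                   ∎
  where
  open ≤-Reasoning
  open +-*-Solver

module _ {x : Vector ℚ n} (binary : ∀ j → x j ≡ 0ℚ ⊎ x j ≡ 1ℚ) where

  signs : Vector Sign n
  signs j = [ const Sign.- , const Sign.+ ]′ (binary j)

  sign-as-difference : (π : Fin k → Permutation′ n) → ∀ i j l →
    (if Vec.lookup (prefix (π i) j) l then signs l ℤ.◃ 1 else 0ℤ) / 1 ≡
    2ℚ * ((+ blockEntry π (i , Fin.suc j) l / 1 - + blockEntry π (i , Fin.zero) l / 1) * (x l - ½))
  sign-as-difference π i j l
    with Vec.lookup (prefix (π i) j) l in lookup≡ | toℕ (π i ⟨$⟩ˡ l) ℕ.<? suc (toℕ j)
  -- Membership and position are tested separately; the two mixed cases contradict the description
  -- of prefixes by positions.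
  ... | false | yes (s≤s l≤j) with () ← trans (sym lookup≡) ([]=⇒lookup (∈-prefix⁺ (π i) l≤j))
  ... | true  | no l≰j = ⊥-elim (l≰j (s≤s (∈-prefix⁻ (π i) (lookup⇒[]= l _ lookup≡))))
  -- Outside the prefix both entries reduce to `toℕ i ℕ.+ 0`, so their difference vanishes whatever
  -- `x l` is.
  ... | false | no _ =
    solve 2 (λ a x → con 0ℚ := con 2ℚ :* ((a :- a) :* (x :- con ½))) refl (+ (toℕ i ℕ.+ 0) / 1) (x l)
    where open +-*-Solver
  -- Inside the prefix the entries are i + 1 and i. Split as sums they visibly differ by 1, which
  -- leaves 2(x - ½), that is -1 or 1.
  ... | true  | yes _
    rewrite /1-homo-+ (+ toℕ i) (+ 1) | /1-homo-+ (+ toℕ i) (+ 0) with binary l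
  ...   | inj₁ x≡0 rewrite x≡0 =
    solve 1 (λ a → con (- 1ℚ) := con 2ℚ :* (((a :+ con 1ℚ) :- (a :+ con 0ℚ)) :* (con 0ℚ :- con ½))) refl (+ toℕ i / 1)
    where open +-*-Solver
  ...   | inj₂ x≡1 rewrite x≡1 =
    solve 1 (λ a → con 1ℚ := con 2ℚ :* (((a :+ con 1ℚ) :- (a :+ con 0ℚ)) :* (con 1ℚ :- con ½))) refl (+ toℕ i / 1)
    where open +-*-Solver

  module _ (π : Fin k → Permutation′ n) {B : ℚ} (0≤B : 0ℚ ≤ B)
           (∣rows∣≤B : ∀ r → ∣ rowError (λ l → + prefixMatrix π r l / 1) x (const ½) ∣ ≤ B) where

    ∣prefix∣≤ : ∀ i j → + ℤ.∣ signs ⟨ prefix (π i) j ⟩ ∣ / 1 ≤ 4ℚ * B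
    ∣prefix∣≤ i j = begin
      + ℤ.∣ signs ⟨ prefix (π i) j ⟩ ∣ / 1  ≡⟨ ∣i∣/1≡∣i/1∣ (signs ⟨ prefix (π i) j ⟩) ⟩
      ∣ signs ⟨ prefix (π i) j ⟩ / 1 ∣      ≡⟨ cong ∣_∣ (sumℤ-as-row-difference (row r₁) (row r₀) x _ signs≡) ⟩
      ∣ 2ℚ * (rowError (row r₁) x (const ½) - rowError (row r₀) x (const ½)) ∣
        ≤⟨ ∣2[p-q]∣≤4r {rowError (row r₁) x (const ½)} {rowError (row r₀) x (const ½)} (∣rows∣≤B r₁) (∣rows∣≤B r₀) ⟩
      4ℚ * B                                ∎
      where
      open ≤-Reasoning
      -- The prefix with index j ends at position j inclusive, hence threshold j + 1; threshold 0 is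
      -- the constant row of the same block.
      r₁ = combine i (Fin.suc j)
      r₀ = combine i (Fin.zero {n})
      row : Fin (k ℕ.* suc n) → Vector ℚ n
      row r l = + prefixMatrix π r l / 1
      signs≡ : ∀ l → (if Vec.lookup (prefix (π i) j) l then signs l ℤ.◃ 1 else 0ℤ) / 1 ≡
                     2ℚ * ((row r₁ l - row r₀ l) * (x l - ½))
      signs≡ l = trans (sign-as-difference π i j l)
        (sym (cong₂ (λ p q → 2ℚ * ((+ p / 1 - + q / 1) * (x l - ½)))
          (blockEntry-combine π i (Fin.suc j) l) (blockEntry-combine π i Fin.zero l)))

    maxDisc-prefixes≤ : + maxDisc (prefixes π) signs / 1 ≤ 4ℚ * B
    maxDisc-prefixes≤ = foldr-preservesᵇ {P = λ d → + d / 1 ≤ 4ℚ * B}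
      (λ {d} {e} d≤ e≤ → [ (λ eq → subst (λ f → + f / 1 ≤ 4ℚ * B) (sym eq) d≤)
                         , (λ eq → subst (λ f → + f / 1 ≤ 4ℚ * B) (sym eq) e≤) ]′ (ℕ.⊔-sel d e))
      -- The fold starts from 0, so 0 itself must obey the bound.
      (*-monoˡ-≤-nonNeg 4ℚ 0≤B)
      (All.map⁺ (All.cartesianProductWith⁺ (setoid _) (setoid _) (λ i j → prefix (π i) j) (allFin k) (allFin n)
        λ {i} {j} _ _ → ∣prefix∣≤ i j))

    disc-prefixes≤ : + disc (prefixes π) / 1 ≤ 4ℚ * B
    disc-prefixes≤ = ≤-trans
      (/1-mono-≤ (ℤ.+≤+ (minOver-≤ (maxDisc (prefixes π)) (maxDisc-cong (prefixes π)) signs)))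
      maxDisc-prefixes≤

-- The centre of the cube and the final estimate.

centre : UnitCube n
centre = (λ _ → fromℚ ½) , λ _ →
    (λ ε 0<ε → 0 , λ _ _ → +-mono-≤ {0ℚ} {½} (*≤* (ℤ.+≤+ z≤n)) (<⇒≤ 0<ε))
  , (λ ε 0<ε → 0 , λ _ _ → +-mono-≤ {½} {1ℚ} (*≤* (ℤ.+≤+ (s≤s z≤n))) (<⇒≤ 0<ε))

-- The bound holds for every binary vector, hence for the minimum. The matrix and the centre are
-- constant sequences, so it holds at each index `t` with no tolerance.
disc-prefixes≤roundingError : (π : Fin k → Permutation′ n) → ∀ t →
  + disc (prefixes π) / 1 ≤ 4ℚ * approx (roundingError (toReal (prefixMatrix π)) centre) t
disc-prefixes≤roundingError π t =
  approx-roundingError (λ e → + disc (prefixes π) / 1 ≤ 4ℚ * e) (toReal (prefixMatrix π)) centre t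
    λ x binary → disc-prefixes≤ binary π

theorem7 : ∀ (k n : ℕ) .{{_ : NonZero k}} .{{_ : NonZero n}} →
    ∀ (dperm : ℕ) (dmon : ℝ) → IsDperm k n dperm → IsDmon k n dmon →
    fromℕ dperm ≤ℝ fromℕ 4 *ℝ dmon
theorem7 k n dperm dmon ((π , disc≡dperm) , _) (_ , lindisc≤dmon) ε 0<ε =
  -- The tolerance gets multiplied by 4 below, so ε/4 is requested here.
  let ¼ = + 1 / 4
      N , error≤ = lindisc≤dmon (prefixMatrix π) (prefixMatrix-monotone π) centre
                     (¼ * ε) (*-monoʳ-<-pos ¼ 0<ε)
  in N , λ t N≤t → begin
    + dperm / 1                           ≡⟨ cong (λ d → + d / 1) disc≡dperm ⟨
    + disc (prefixes π) / 1               ≤⟨ disc-prefixes≤roundingError π t ⟩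
    4ℚ * approx (roundingError (toReal (prefixMatrix π)) centre) t
                                          ≤⟨ *-monoˡ-≤-nonNeg 4ℚ (error≤ t N≤t) ⟩
    4ℚ * (approx dmon t + ¼ * ε)          ≡⟨ solve 2 (λ d ε → con 4ℚ :* (d :+ con (+ 1 / 4) :* ε) := con 4ℚ :* d :+ ε)
                                               refl (approx dmon t) ε ⟩
    4ℚ * approx dmon t + ε                ∎
  where
  open ≤-Reasoning
  open +-*-Solver
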